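{- Let $\Gamma$ be a 1-valid constraint language. If $\mathrm{SAT}(\Gamma^+)$ can be decided in time $O^*(c^n)$ for some $c\le 2$, then $\mathrm{P\text{ - }ABD}(\Gamma)$ can be decided in time $O^*(c^n)$.
   Context: A constraint language $\Gamma$ is a set of relations $R\subseteq\{0,1\}^k$; it is 1-valid if every $R\in\Gamma$ contains the all-ones tuple. $\Gamma^+=\Gamma\cup\{\{(0)\},\{(1)\}\}$. $\mathrm{SAT}(\Gamma)$ asks whether a conjunction of constraints $R(x_1,\dots,x_k)$, $R\in\Gamma$, is satisfiable; $n$ denotes the number of variables. An instance of $\mathrm{P\text{ - }ABD}(\Gamma)$ is $(\mathrm{KB},H,M)$ with $\mathrm{KB}$ a $\Gamma$-formula, $H,M$ sets of variables, $n=|\mathrm{var}(\mathrm{KB})\cup H\cup M|$; it asks whether there is $E\subseteq H$ with $\mathrm{KB}\wedge E$ satisfiable and $\mathrm{KB}\wedge E\models m$ for all $m\in M$. $O^*$ suppresses polynomial factors. -}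

module Defs where

open import Algebra.Definitions.RawSemiring using (_^_)
open import Data.Bool using (Bool; true; false; not)
open import Data.Fin using (Fin; zero)
open import Data.Integer using (+_)
open import Data.List using (List; []; _∷_; _++_; map; length; concatMap; deduplicate; foldr)
open import Data.List.Relation.Binary.Subset.Propositional using (_⊆_)
open import Data.List.Relation.Unary.All using (All)
open import Data.Nat as ℕ using (ℕ; suc; _+_)
open import Data.Nat.Binary as ℕᵇ using (ℕᵇ; 2[1+_]; 1+[2_])
open import Data.Product using (_×_; _,_; ∃; ∃₂)
open import Data.Rational as ℚ using (ℚ; 0ℚ; +-*-rawSemiring)
open import Data.Sum using (_⊎_)
open import Data.Vec as Vec using (Vec; []; _∷_; lookup; replicate; _[_]≔_)
open import Level using (Level) renaming (suc to lsuc)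
open import Relation.Binary.PropositionalEquality using (_≡_; _≢_; _≗_; sym; trans)
open import Relation.Nullary using (¬_; Reflects)

private
  variable
    ℓ : Level
    k l : ℕ

-- Two-sided Dedekind cuts: q <c and c< q compare the rational q with the
-- real number c being defined.
record ℝ≥0 : Set₁ where
  field
    _<c     : ℚ → Set
    c<_     : ℚ → Set
    lower   : ∃ _<c
    upper   : ∃ c<_
    rounded<c : ∀ {q} → (q <c → ∃ λ r → q ℚ.< r × r <c) × ((∃ λ r → q ℚ.< r × r <c) → q <c)
    roundedc< : ∀ {q} → (c< q → ∃ λ r → r ℚ.< q × c< r) × ((∃ λ r → r ℚ.< q × c< r) → c< q)
    disjoint : ∀ {q} → ¬ (q <c × c< q)
    located  : ∀ {q r} → q ℚ.< r → q <c ⊎ c< r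
    nonNeg   : ∀ {q} → c< q → 0ℚ ℚ.< q

fromℕ : ℕ → ℚ
fromℕ n = + n ℚ./ 1

_≤ᴿ_ : ℝ≥0 → ℚ → Set
c ≤ᴿ r = ∀ {q} → q <c → q ℚ.< r
  where open ℝ≥0 c

-- t ≤ a · cⁿ. As c ≥ 0, the real number a · cⁿ is the infimum of a · qⁿ
-- over the rationals q > c.
_≤_·_^ᴿ_ : ℕ → ℕ → ℝ≥0 → ℕ → Set
t ≤ a · c ^ᴿ n = ∀ {q} → c< q → fromℕ t ℚ.≤ fromℕ a ℚ.* _^_ +-*-rawSemiring q n
  where open ℝ≥0 c

-- Machine model: the WHILE language over binary trees (N. D. Jones,
-- "Computability and Complexity"), charging one unit for every
-- elementary operation. Up to factors logarithmic in the running time it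
-- is equivalent to the RAM with logarithmically bounded words.
data Tree : Set where
  nil  : Tree
  cons : Tree → Tree → Tree

size : Tree → ℕ
size nil        = 1
size (cons a b) = suc (size a + size b)

hdᵀ tlᵀ : Tree → Tree
hdᵀ nil        = nil
hdᵀ (cons a b) = a
tlᵀ nil        = nil
tlᵀ (cons a b) = b

data Expr (k : ℕ) : Set where
  var   : Fin k → Expr k
  nil   : Expr k
  cons  : Expr k → Expr k → Expr k
  hd tl : Expr k → Expr k

infix  6 _:=_
infixr 5 _⨾_

data Command (k : ℕ) : Set where
  _:=_     : Fin k → Expr k → Command k
  _⨾_      : Command k → Command k → Command k
  while    : Expr k → Command k → Command k

Store : ℕ → Set
Store k = Vec Tree k

eval : Expr k → Store k → Tree
eval (var x)    s = lookup s x
eval nil        s = nil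
eval (cons e f) s = cons (eval e s) (eval f s)
eval (hd e)     s = hdᵀ (eval e s)
eval (tl e)     s = tlᵀ (eval e s)

cost : Expr k → ℕ
cost (var x)    = 1
cost nil        = 1
cost (cons e f) = suc (cost e + cost f)
cost (hd e)     = suc (cost e)
cost (tl e)     = suc (cost e)

-- ⟨ C , s ⟩⇓ s′ [ t ]: started in store s, the command C halts in store
-- s′ after t time units.
data ⟨_,_⟩⇓_[_] {k : ℕ} : Command k → Store k → Store k → ℕ → Set where
  assign : ∀ {x e s} →
           ⟨ x := e , s ⟩⇓ (s [ x ]≔ eval e s) [ suc (cost e) ]
  seq    : ∀ {C D s s′ s″ t u} →
           ⟨ C , s ⟩⇓ s′ [ t ] → ⟨ D , s′ ⟩⇓ s″ [ u ] →
           ⟨ C ⨾ D , s ⟩⇓ s″ [ t + u ]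
  stop   : ∀ {e C s} → eval e s ≡ nil →
           ⟨ while e C , s ⟩⇓ s [ suc (cost e) ]
  loop   : ∀ {e C s s′ s″ t u} → eval e s ≢ nil →
           ⟨ C , s ⟩⇓ s′ [ t ] → ⟨ while e C , s′ ⟩⇓ s″ [ u ] →
           ⟨ while e C , s ⟩⇓ s″ [ suc (cost e) + (t + u) ]

-- Variable zero holds the input at the start and the output at the end;
-- all other variables are initially nil.
record Program : Set where
  field
    {auxiliary} : ℕ
    body        : Command (suc auxiliary)

_on_⇒_[_] : Program → Tree → Tree → ℕ → Set
P on d ⇒ d′ [ t ] =
  ∃ λ s → ⟨ body , d ∷ replicate auxiliary nil ⟩⇓ s [ t ] × lookup s zero ≡ d′
  where open Program P

bool : Bool → Tree
bool false = nil
bool true  = cons nil nil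

record Problem (ℓ : Level) : Set (lsuc ℓ) where
  field
    Instance : Set ℓ
    Yes      : Instance → Set ℓ
    encode   : Instance → Tree
    #vars    : Instance → ℕ

-- Coefficients, constant term first.
Polynomial : Set
Polynomial = List ℕ

_⟪_⟫ : Polynomial → ℕ → ℕ
p ⟪ x ⟫ = foldr (λ a b → a + x ℕ.* b) 0 p

-- The suppressed factor is polynomial in the size of the encoded instance.
DecidableInO*_^n : ℝ≥0 → Problem ℓ → Set ℓ
DecidableInO* c ^n Π =
  ∃₂ λ (P : Program) (p : Polynomial) → ∀ (I : Instance) →
  ∃₂ λ (b : Bool) (t : ℕ) →
    P on encode I ⇒ bool b [ t ] ×
    Reflects (Yes I) b ×
    t ≤ p ⟪ size (encode I) ⟫ · c ^ᴿ #vars I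
  where open Problem Π

BoolRel : ℕ → Set
BoolRel k = Vec Bool k → Bool

-- A set of relations; since relations are characteristic functions, it
-- has to respect their extensional equality.
record Language (ℓ : Level) : Set (lsuc ℓ) where
  field
    _∋_  : ∀ {k} → BoolRel k → Set ℓ
    resp : ∀ {k} {R S : BoolRel k} → R ≗ S → _∋_ R → _∋_ S

open Language public using () renaming (_∋_ to infix 4 _∋_)

OneValid : Language ℓ → Set ℓ
OneValid Γ = ∀ {k} {R : BoolRel k} → Γ ∋ R → R (replicate k true) ≡ true

｛0｝ ｛1｝ : BoolRel 1
｛0｝ (x ∷ []) = not x
｛1｝ (x ∷ []) = x

data Extended (Γ : Language ℓ) : BoolRel k → Set ℓ where
  base    : {R : BoolRel k} → Γ ∋ R → Extended Γ R
  isFalse : {R : BoolRel 1} → R ≗ ｛0｝ → Extended Γ R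
  isTrue  : {R : BoolRel 1} → R ≗ ｛1｝ → Extended Γ R

_⁺ : Language ℓ → Language ℓ
Γ ⁺ = record { _∋_ = Extended Γ ; resp = resp⁺ }
  where
  resp⁺ : {R S : BoolRel k} → R ≗ S → Extended Γ R → Extended Γ S
  resp⁺ eq (base R∈Γ)  = base (Language.resp Γ eq R∈Γ)
  resp⁺ eq (isFalse h) = isFalse (λ x → trans (sym (eq x)) (h x))
  resp⁺ eq (isTrue h)  = isTrue (λ x → trans (sym (eq x)) (h x))

-- How relations are written down in the input (truth tables, lists of
-- tuples, clauses, circuits, ...): every relation has at least one name,
-- and the code of a name determines it. For infinite languages the input
-- size depends on this choice, so it is kept as a parameter.
record Representation : Set₁ where
  field
    Name     : ℕ → Set
    ⟦_⟧      : Name k → BoolRel k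
    complete : (R : BoolRel k) → ∃ λ (r : Name k) → ⟦ r ⟧ ≗ R
    code     : Name k → Tree
    code-injective : {r : Name k} {s : Name l} → code r ≡ code s →
                     _≡_ {A = ∃ Name} (k , r) (l , s)

Var : Set
Var = ℕ

Assignment : Set
Assignment = Var → Bool

#distinct : List Var → ℕ
#distinct xs = length (deduplicate ℕ._≟_ xs)

list : List Tree → Tree
list = foldr cons nil

encodeBinary : ℕᵇ → Tree
encodeBinary ℕᵇ.zero  = nil
encodeBinary 2[1+ b ] = cons nil (encodeBinary b)
encodeBinary 1+[2 b ] = cons (cons nil nil) (encodeBinary b)

encodeVar : Var → Tree
encodeVar x = encodeBinary (ℕᵇ.fromℕ x)

encodeVars : List Var → Tree
encodeVars xs = list (map encodeVar xs)

module _ (ρ : Representation) where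
  open Representation ρ

  record Constraint (Γ : Language ℓ) : Set ℓ where
    field
      {arity} : ℕ
      name    : Name arity
      args    : Vec Var arity
      name∈Γ  : Γ ∋ ⟦ name ⟧

  Formula : Language ℓ → Set ℓ
  Formula Γ = List (Constraint Γ)

  -- The lists H and M stand for the sets of their elements.
  record AbductionInstance (Γ : Language ℓ) : Set ℓ where
    field
      KB : Formula Γ
      H  : List Var
      M  : List Var

module _ {ρ : Representation} {Γ : Language ℓ} where
  open Representation ρ
  open Constraint

  vars : Formula ρ Γ → List Var
  vars = concatMap (λ C → Vec.toList (args C))

  encodeConstraint : Constraint ρ Γ → Tree
  encodeConstraint C = cons (code (name C)) (encodeVars (Vec.toList (args C)))

  encodeFormula : Formula ρ Γ → Tree
  encodeFormula φ = list (map encodeConstraint φ)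

  infix 4 _⊨_ _⊨_∧_

  _⊨_ : Assignment → Formula ρ Γ → Set ℓ
  σ ⊨ φ = All (λ C → ⟦ name C ⟧ (Vec.map σ (args C)) ≡ true) φ

  _⊨_∧_ : Assignment → Formula ρ Γ → List Var → Set ℓ
  σ ⊨ φ ∧ E = σ ⊨ φ × All (λ x → σ x ≡ true) E

  Explanation : AbductionInstance ρ Γ → List Var → Set ℓ
  Explanation I E =
    E ⊆ H ×
    (∃ λ σ → σ ⊨ KB ∧ E) ×
    All (λ m → ∀ σ → σ ⊨ KB ∧ E → σ m ≡ true) M
    where open AbductionInstance I

SAT : Representation → Language ℓ → Problem ℓ
SAT ρ Γ = record
  { Instance = Formula ρ Γ
  ; Yes      = λ φ → ∃ λ σ → σ ⊨ φ
  ; encode   = encodeFormula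
  ; #vars    = λ φ → #distinct (vars φ)
  }

P-ABD : Representation → Language ℓ → Problem ℓ
P-ABD ρ Γ = record
  { Instance = AbductionInstance ρ Γ
  ; Yes      = λ I → ∃ (Explanation I)
  ; encode   = λ I → cons (encodeFormula (KB I)) (cons (encodeVars (H I)) (encodeVars (M I)))
  ; #vars    = λ I → #distinct (vars (KB I) ++ H I ++ M I)
  }
  where open AbductionInstance

{-# OPTIONS --safe #-}

-- Since Γ is 1-valid, the all-ones assignment satisfies KB ∧ H, and enlarging
-- E only strengthens what KB ∧ E entails. Hence there is an explanation iff
-- E = H is one, that is, iff for each m ∈ M the Γ⁺-formula KB ∧ H ∧ ¬m is
-- unsatisfiable, which takes |M| calls to the decision procedure for SAT(Γ⁺)
-- on formulas with at most n variables.
--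
-- The bounds cᵏ for the calls, where k ≤ n, and the polynomial overhead are
-- absorbed by cⁿ only if c ≥ 1. This follows from the hypothesis: the formulas
-- x₀ ∧ … ∧ xₙ₋₁ have size polynomial in n and cost at least one step each,
-- whereas a polynomial times cⁿ tends to 0 for c < 1.
module Submission where

open import Defs
open import Algebra.Bundles using (CommutativeMonoid)
open import Algebra.Definitions.RawSemiring using () renaming (_^_ to pow)
open import Data.Bool as Bool using (true; false; not; T)
open import Data.Fin using (Fin; zero; suc; _↑ˡ_; _↑ʳ_)
open import Data.Integer as ℤ using () renaming (+_ to pos)
import Data.Integer.Properties as ℤ
open import Data.List as List using (List; []; _∷_; [_]; _++_; map; length; downFrom)
open import Data.List.Membership.Propositional using (_∈_)
open import Data.List.Membership.Propositional.Properties using (∈-∃++; ∈-++⁺ˡ; ∈-++⁺ʳ; ∈-++⁻; ∈-deduplicate⁺; ∈-deduplicate⁻)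
open import Data.List.Properties using (length-++; length-map; length-downFrom; length-deduplicate)
open import Data.List.Relation.Binary.Subset.Propositional using (_⊆_)
open import Data.List.Relation.Unary.All as All using (All; []; _∷_)
import Data.List.Relation.Unary.All.Properties as All
open import Data.List.Relation.Unary.AllPairs using (_∷_)
open import Data.List.Relation.Unary.Any using (here; there)
open import Data.List.Relation.Unary.Unique.DecPropositional.Properties using (deduplicate-!)
open import Data.List.Relation.Unary.Unique.Propositional using (Unique)
open import Data.List.Relation.Unary.Unique.Propositional.Properties using (downFrom⁺)
open import Data.Nat using (ℕ; zero; suc; _+_; _*_; _^_; _≤_; _<_; z≤n; s≤s; NonZero)
open import Data.Nat.Binary as ℕᵇ using (2[1+_]; 1+[2_])
import Data.Nat.Binary.Properties as ℕᵇ
open import Data.Nat.ListAction using (sum)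
open import Data.Nat.Properties
open import Data.Nat.Tactic.RingSolver using (solve-∀)
open import Data.Product using (∃; ∃₂; _×_; _,_; proj₁; proj₂)
open import Data.Rational as ℚ using (ℚ; mkℚ; 0ℚ; 1ℚ; +-*-rawSemiring; *≤*; toℚᵘ)
import Data.Rational.Properties as ℚ
open import Data.Rational.Unnormalised as ℚᵘ using (mkℚᵘ; *≡*)
import Data.Rational.Unnormalised.Properties as ℚᵘ
open import Data.Sum as Sum using (_⊎_; inj₁; inj₂)
open import Data.Unit using (tt)
open import Data.Vec as Vec using (Vec; []; _∷_; lookup; _[_]≔_)
open import Data.Vec.Properties using (lookup-++ˡ; lookup-++ʳ; []≔-++-↑ˡ; []≔-++-↑ʳ)
open import Function using (_∘_)
open import Level using (Level)
open import Relation.Binary.PropositionalEquality using (_≡_; _≢_; refl; sym; trans; cong; cong₂; subst; subst₂; module ≡-Reasoning)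
open import Relation.Nullary using (¬_; Reflects; ofʸ; ofⁿ; contradiction; yes; no)

-- Counting distinct variables.

Unique∧⊆⇒length≤ : ∀ {a} {A : Set a} {xs ys : List A} →
  Unique xs → xs ⊆ ys → length xs ≤ length ys
Unique∧⊆⇒length≤ {xs = []} _ _ = z≤n
Unique∧⊆⇒length≤ {xs = x ∷ xs} (x∉xs ∷ xs!) xs⊆ys
  with ys₁ , ys₂ , refl ← ∈-∃++ (xs⊆ys (here refl)) = begin
  suc (length xs)                ≤⟨ s≤s (Unique∧⊆⇒length≤ xs! xs⊆) ⟩
  suc (length (ys₁ ++ ys₂))      ≡⟨ cong suc (length-++ ys₁) ⟩
  suc (length ys₁ + length ys₂)  ≡⟨ +-suc (length ys₁) (length ys₂) ⟨
  length ys₁ + suc (length ys₂)  ≡⟨ length-++ ys₁ ⟨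
  length (ys₁ ++ x ∷ ys₂)        ∎
  where
  open ≤-Reasoning
  -- One occurrence of `x` is cut out of `ys`; the other entries of `xs` differ from `x`, so they
  -- survive the cut.
  xs⊆ : xs ⊆ ys₁ ++ ys₂
  xs⊆ z∈xs with ∈-++⁻ ys₁ (xs⊆ys (there z∈xs))
  ... | inj₁ z∈ys₁         = ∈-++⁺ˡ z∈ys₁
  ... | inj₂ (here refl)   = contradiction refl (All.lookup x∉xs z∈xs)
  ... | inj₂ (there z∈ys₂) = ∈-++⁺ʳ ys₁ z∈ys₂

#distinct-mono : ∀ {xs ys} → xs ⊆ ys → #distinct xs ≤ #distinct ys
#distinct-mono {xs} xs⊆ys = Unique∧⊆⇒length≤ (deduplicate-! _≟_ xs)
  λ x∈ → ∈-deduplicate⁺ _≟_ (xs⊆ys (∈-deduplicate⁻ _≟_ xs x∈))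

#distinct-Unique : ∀ {xs} → Unique xs → #distinct xs ≡ length xs
#distinct-Unique {xs} xs! =
  ≤-antisym (length-deduplicate _≟_ xs) (Unique∧⊆⇒length≤ xs! (∈-deduplicate⁺ _≟_))

-- Embedding ℕ into ℚ

infixr 8 _^ℚ_
_^ℚ_ : ℚ → ℕ → ℚ
_^ℚ_ = pow +-*-rawSemiring

-- `fromℕ n` is normalised by a gcd, which does not reduce for a variable `n`. Unnormalised
-- rationals avoid this: there the facts below become integer identities.
toℚᵘ-fromℕ : ∀ n → toℚᵘ (fromℕ n) ℚᵘ.≃ mkℚᵘ (pos n) 0
toℚᵘ-fromℕ n = ℚ.toℚᵘ-fromℚᵘ (mkℚᵘ (pos n) 0)

fromℕ-+ : ∀ m n → fromℕ (m + n) ≡ fromℕ m ℚ.+ fromℕ n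
fromℕ-+ m n = ℚ.toℚᵘ-injective (begin-equality
  toℚᵘ (fromℕ (m + n))                      ≃⟨ toℚᵘ-fromℕ (m + n) ⟩
  mkℚᵘ (pos (m + n)) 0
    ≃⟨ *≡* (cong (ℤ._* pos 1) (sym (cong₂ ℤ._+_ (ℤ.*-identityʳ (pos m)) (ℤ.*-identityʳ (pos n))))) ⟩
  mkℚᵘ (pos m) 0 ℚᵘ.+ mkℚᵘ (pos n) 0            ≃⟨ ℚᵘ.+-cong (toℚᵘ-fromℕ m) (toℚᵘ-fromℕ n) ⟨
  toℚᵘ (fromℕ m) ℚᵘ.+ toℚᵘ (fromℕ n)        ≃⟨ ℚ.toℚᵘ-homo-+ (fromℕ m) (fromℕ n) ⟨
  toℚᵘ (fromℕ m ℚ.+ fromℕ n)                ∎)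
  where open ℚᵘ.≤-Reasoning

fromℕ-* : ∀ m n → fromℕ (m * n) ≡ fromℕ m ℚ.* fromℕ n
fromℕ-* m n = ℚ.toℚᵘ-injective (begin-equality
  toℚᵘ (fromℕ (m * n))                      ≃⟨ toℚᵘ-fromℕ (m * n) ⟩
  mkℚᵘ (pos (m * n)) 0                        ≃⟨ *≡* (cong (ℤ._* pos 1) (ℤ.pos-* m n)) ⟩
  mkℚᵘ (pos m) 0 ℚᵘ.* mkℚᵘ (pos n) 0            ≃⟨ ℚᵘ.*-cong (toℚᵘ-fromℕ m) (toℚᵘ-fromℕ n) ⟨
  toℚᵘ (fromℕ m) ℚᵘ.* toℚᵘ (fromℕ n)        ≃⟨ ℚ.toℚᵘ-homo-* (fromℕ m) (fromℕ n) ⟨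
  toℚᵘ (fromℕ m ℚ.* fromℕ n)                ∎)
  where open ℚᵘ.≤-Reasoning

fromℕ-mono : ∀ {m n} → m ≤ n → fromℕ m ℚ.≤ fromℕ n
fromℕ-mono {m} {n} m≤n = ℚ.toℚᵘ-cancel-≤ (begin
  toℚᵘ (fromℕ m) ≃⟨ toℚᵘ-fromℕ m ⟩
  mkℚᵘ (pos m) 0   ≤⟨ ℚᵘ.*≤* (ℤ.*-monoʳ-≤-nonNeg (pos 1) (ℤ.+≤+ m≤n)) ⟩
  mkℚᵘ (pos n) 0   ≃⟨ toℚᵘ-fromℕ n ⟨
  toℚᵘ (fromℕ n) ∎)
  where open ℚᵘ.≤-Reasoning

fromℕ-cancel : ∀ {m n} → fromℕ m ℚ.≤ fromℕ n → m ≤ n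
fromℕ-cancel {m} {n} fm≤fn =
  ℤ.drop‿+≤+ (subst₂ ℤ._≤_ (ℤ.*-identityʳ (pos m)) (ℤ.*-identityʳ (pos n)) (ℚᵘ.drop-*≤* (begin
  mkℚᵘ (pos m) 0   ≃⟨ toℚᵘ-fromℕ m ⟨
  toℚᵘ (fromℕ m) ≤⟨ ℚ.toℚᵘ-mono-≤ fm≤fn ⟩
  toℚᵘ (fromℕ n) ≃⟨ toℚᵘ-fromℕ n ⟩
  mkℚᵘ (pos n) 0   ∎)))
  where open ℚᵘ.≤-Reasoning

fromℕ-nonNeg : ∀ n → ℚ.NonNegative (fromℕ n)
fromℕ-nonNeg n = ℚ.nonNegative (fromℕ-mono {0} {n} z≤n)

*-↧ₙ : ∀ q {a} → ℚ.↥ q ≡ pos a → q ℚ.* fromℕ (ℚ.↧ₙ q) ≡ fromℕ a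
*-↧ₙ q@(mkℚ _ d-1 _) {a} refl = ℚ.toℚᵘ-injective (begin-equality
  toℚᵘ (q ℚ.* fromℕ (suc d-1))          ≃⟨ ℚ.toℚᵘ-homo-* q (fromℕ (suc d-1)) ⟩
  toℚᵘ q ℚᵘ.* toℚᵘ (fromℕ (suc d-1))    ≃⟨ ℚᵘ.*-cong {x = toℚᵘ q} ℚᵘ.≃-refl (toℚᵘ-fromℕ (suc d-1)) ⟩
  mkℚᵘ (pos a) d-1 ℚᵘ.* mkℚᵘ (pos (suc d-1)) 0
    ≃⟨ *≡* (trans (ℤ.*-identityʳ _) (cong (pos a ℤ.*_) (cong pos (sym (*-identityʳ (suc d-1)))))) ⟩
  mkℚᵘ (pos a) 0                          ≃⟨ toℚᵘ-fromℕ a ⟨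
  toℚᵘ (fromℕ a)                        ∎)
  where open ℚᵘ.≤-Reasoning

-- Moves a comparison of powers of `q = a/b` to powers of `a` and `b` in ℕ, where growth can be
-- estimated.
^ℚ-clear-denominator : ∀ {q a b} → q ℚ.* fromℕ b ≡ fromℕ a →
  ∀ n → q ^ℚ n ℚ.* fromℕ (b ^ n) ≡ fromℕ (a ^ n)
^ℚ-clear-denominator eq zero = refl
^ℚ-clear-denominator {q} {a} {b} eq (suc n) = begin
  (q ℚ.* q ^ℚ n) ℚ.* fromℕ (b * b ^ n)
    ≡⟨ cong ((q ℚ.* q ^ℚ n) ℚ.*_) (fromℕ-* b (b ^ n)) ⟩
  (q ℚ.* q ^ℚ n) ℚ.* (fromℕ b ℚ.* fromℕ (b ^ n))
    ≡⟨ interchange q (q ^ℚ n) (fromℕ b) (fromℕ (b ^ n)) ⟩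
  (q ℚ.* fromℕ b) ℚ.* (q ^ℚ n ℚ.* fromℕ (b ^ n))  ≡⟨ cong₂ ℚ._*_ eq (^ℚ-clear-denominator eq n) ⟩
  fromℕ a ℚ.* fromℕ (a ^ n)                       ≡⟨ fromℕ-* a (a ^ n) ⟨
  fromℕ (a * a ^ n)                               ∎
  where
  open ≡-Reasoning
  open import Algebra.Properties.CommutativeSemigroup
    (CommutativeMonoid.commutativeSemigroup ℚ.*-1-commutativeMonoid) using (interchange)

-- Exponentials outgrow polynomials

n<2^n : ∀ n → n < 2 ^ n
n<2^n zero    = s≤s z≤n
n<2^n (suc n) = begin-strict
  suc n         ≤⟨ n<2^n n ⟩
  2 ^ n         <⟨ m<m+n (2 ^ n) (≤-<-trans z≤n (n<2^n n)) ⟩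
  2 ^ n + 2 ^ n ≡⟨ cong ((2 ^ n) +_) (+-identityʳ (2 ^ n)) ⟨
  2 ^ suc n     ∎
  where open ≤-Reasoning

^-distribʳ-* : ∀ n a b → (a * b) ^ n ≡ a ^ n * b ^ n
^-distribʳ-* zero    a b = refl
^-distribʳ-* (suc n) a b = begin
  a * b * (a * b) ^ n       ≡⟨ cong (a * b *_) (^-distribʳ-* n a b) ⟩
  a * b * (a ^ n * b ^ n)   ≡⟨ [m*n]*[o*p]≡[m*o]*[n*p] a b (a ^ n) (b ^ n) ⟩
  a * a ^ n * (b * b ^ n)   ∎
  where open ≡-Reasoning

monomial<exponential : ∀ A e → ∃ λ j → 1 ≤ j × A * j ^ e < 2 ^ j
monomial<exponential A e = 2 ^ i , m^n>0 2 i , (begin-strict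
  A * (2 ^ i) ^ e     ≡⟨ cong (A *_) (^-*-assoc 2 i e) ⟩
  A * 2 ^ (i * e)     <⟨ *-monoˡ-< (2 ^ (i * e)) ⦃ m^n≢0 2 (i * e) ⦄ (n<2^n A) ⟩
  2 ^ A * 2 ^ (i * e) ≡⟨ ^-distribˡ-+-* 2 A (i * e) ⟨
  2 ^ (A + i * e)     ≤⟨ ^-monoʳ-≤ 2 A+ie≤2^i ⟩
  2 ^ (2 ^ i)         ∎)
  where
  open ≤-Reasoning
  m i : ℕ
  m = A + 2 * e
  i = m + m
  expand : ∀ A e → suc (A + 2 * e) * suc (A + 2 * e) ≡
    (A + (A + 2 * e + (A + 2 * e)) * e) + (1 + A + 4 * e + A * A + 2 * (A * e))
  expand = solve-∀
  A+ie≤2^i : A + i * e ≤ 2 ^ i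
  A+ie≤2^i = begin
    A + i * e     ≤⟨ m≤m+n _ _ ⟩
    _             ≡⟨ expand A e ⟨
    suc m * suc m ≤⟨ *-mono-≤ (n<2^n m) (n<2^n m) ⟩
    2 ^ m * 2 ^ m ≡⟨ ^-distribˡ-+-* 2 m m ⟨
    2 ^ i         ∎

-- The inequality `1 + n/a ≤ (1 + 1/a)ⁿ`, multiplied by `aⁿ⁺¹` to stay in ℕ.
bernoulli : ∀ a n → a ^ n * (a + n) ≤ suc a ^ n * a
bernoulli a zero    = ≤-reflexive (cong (1 *_) (+-identityʳ a))
bernoulli a (suc n) = begin
  a * a ^ n * (a + suc n)            ≤⟨ m≤m+n _ _ ⟩
  a * a ^ n * (a + suc n) + a ^ n * n ≡⟨ expand a n (a ^ n) ⟩
  suc a * (a ^ n * (a + n))          ≤⟨ *-monoʳ-≤ (suc a) (bernoulli a n) ⟩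
  suc a * (suc a ^ n * a)            ≡⟨ *-assoc (suc a) (suc a ^ n) a ⟨
  suc a * suc a ^ n * a              ∎
  where
  open ≤-Reasoning
  expand : ∀ a n x → a * x * (a + suc n) + x * n ≡ suc a * (x * (a + n))
  expand = solve-∀

2*a^a≤[1+a]^a : ∀ a .⦃ _ : NonZero a ⦄ → 2 * a ^ a ≤ suc a ^ a
2*a^a≤[1+a]^a a = *-cancelʳ-≤ _ _ a (begin
  2 * a ^ a * a   ≡⟨ expand a (a ^ a) ⟩
  a ^ a * (a + a) ≤⟨ bernoulli a a ⟩
  suc a ^ a * a   ∎)
  where
  open ≤-Reasoning
  expand : ∀ a x → 2 * x * a ≡ x * (a + a)
  expand = solve-∀

-- Take `n = a * j`. By Bernoulli the ratio `((1 + a)/a)ⁿ` is at least `2 ^ j`, while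
-- `1 + a * j ≤ (1 + a) * j` turns the polynomial factor into a monomial in `j`, which `2 ^ j`
-- exceeds for a suitable `j`.
monomial*exponential<exponential : ∀ a A e .⦃ _ : NonZero a ⦄ → ∃ λ n → A * suc n ^ e * a ^ n < suc a ^ n
monomial*exponential<exponential a A e
  with j , 1≤j , lt ← monomial<exponential (A * suc a ^ e) e = a * j , (begin-strict
  A * suc (a * j) ^ e * a ^ (a * j)
    ≤⟨ *-monoˡ-≤ (a ^ (a * j)) (*-monoʳ-≤ A (^-monoˡ-≤ e (+-monoˡ-≤ (a * j) 1≤j))) ⟩
  A * (suc a * j) ^ e * a ^ (a * j)
    ≡⟨ cong (λ x → A * x * a ^ (a * j)) (^-distribʳ-* e (suc a) j) ⟩
  A * (suc a ^ e * j ^ e) * a ^ (a * j) ≡⟨ cong (_* a ^ (a * j)) (*-assoc A (suc a ^ e) (j ^ e)) ⟨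
  A * suc a ^ e * j ^ e * a ^ (a * j)  <⟨ *-monoˡ-< (a ^ (a * j)) ⦃ m^n≢0 a (a * j) ⦄ lt ⟩
  2 ^ j * a ^ (a * j)                  ≡⟨ cong ((2 ^ j) *_) (^-*-assoc a a j) ⟨
  2 ^ j * (a ^ a) ^ j                  ≡⟨ ^-distribʳ-* j 2 (a ^ a) ⟨
  (2 * a ^ a) ^ j                      ≤⟨ ^-monoˡ-≤ j (2*a^a≤[1+a]^a a) ⟩
  (suc a ^ a) ^ j                      ≡⟨ ^-*-assoc (suc a) a j ⟩
  suc a ^ (a * j)                      ∎)
  where open ≤-Reasoning

-- Write `q = a/b` and suppose `a < b`. Clearing denominators gives `bⁿ ≤ A(n+1)ᵉaⁿ` for all `n`,
-- but for some `n` the right side is below `(a+1)ⁿ ≤ bⁿ`.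
monomial-bound⇒1≤ : ∀ {q} → 0ℚ ℚ.< q → ∀ A e →
  (∀ n → 1ℚ ℚ.≤ fromℕ (A * suc n ^ e) ℚ.* q ^ℚ n) → 1ℚ ℚ.≤ q
monomial-bound⇒1≤ {mkℚ (pos zero) d-1 _} (ℚ.*<* (ℤ.+<+ ())) A e bound
monomial-bound⇒1≤ {mkℚ ℤ.-[1+ a ] d-1 _} (ℚ.*<* ()) A e bound
monomial-bound⇒1≤ {q@(mkℚ (pos a@(suc _)) d-1 _)} 0<q A e bound with a <? suc d-1
... | no b≤a = *≤* (subst₂ ℤ._≤_ (sym (ℤ.*-identityˡ _)) (sym (ℤ.*-identityʳ _)) (ℤ.+≤+ (≮⇒≥ b≤a)))
... | yes a<b with n , lt ← monomial*exponential<exponential a A e =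
  contradiction (≤-<-trans b^n≤ (<-≤-trans lt (^-monoˡ-≤ n a<b))) (<-irrefl refl)
  where
  b = suc d-1
  open ℚ.≤-Reasoning
  b^n≤ : b ^ n ≤ A * suc n ^ e * a ^ n
  b^n≤ = fromℕ-cancel (begin
    fromℕ (b ^ n)                                              ≡⟨ ℚ.*-identityˡ _ ⟨
    1ℚ ℚ.* fromℕ (b ^ n)
      ≤⟨ ℚ.*-monoʳ-≤-nonNeg _ ⦃ fromℕ-nonNeg (b ^ n) ⦄ (bound n) ⟩
    (fromℕ (A * suc n ^ e) ℚ.* q ^ℚ n) ℚ.* fromℕ (b ^ n)
      ≡⟨ ℚ.*-assoc (fromℕ (A * suc n ^ e)) (q ^ℚ n) (fromℕ (b ^ n)) ⟩
    fromℕ (A * suc n ^ e) ℚ.* (q ^ℚ n ℚ.* fromℕ (b ^ n))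
      ≡⟨ cong (fromℕ (A * suc n ^ e) ℚ.*_) (^ℚ-clear-denominator (*-↧ₙ q refl) n) ⟩
    fromℕ (A * suc n ^ e) ℚ.* fromℕ (a ^ n)                    ≡⟨ fromℕ-* (A * suc n ^ e) (a ^ n) ⟨
    fromℕ (A * suc n ^ e * a ^ n)                              ∎)

-- Monotonicity of powers and arithmetic of the bounds `a · cⁿ`.

^ℚ-nonNeg : ∀ {q} → 0ℚ ℚ.< q → ∀ n → ℚ.NonNegative (q ^ℚ n)
^ℚ-nonNeg 0<q zero = _
^ℚ-nonNeg {q} 0<q (suc n) =
  ℚ.nonNeg*nonNeg⇒nonNeg q ⦃ ℚ.nonNegative (ℚ.<⇒≤ 0<q) ⦄ (q ^ℚ n) ⦃ ^ℚ-nonNeg 0<q n ⦄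

-- Stated through the upper cut, the only side of `c` that the time bounds consult.
1≤ᴿ_ : ℝ≥0 → Set
1≤ᴿ c = ∀ {q} → c< q → 1ℚ ℚ.≤ q
  where open ℝ≥0 c

^ℚ-mono : ∀ {q m n} → 1ℚ ℚ.≤ q → m ≤ n → q ^ℚ m ℚ.≤ q ^ℚ n
^ℚ-mono {q} {n = zero}  1≤q z≤n = ℚ.≤-refl
^ℚ-mono {q} {n = suc n} 1≤q z≤n = begin
  1ℚ              ≤⟨ 1≤q ⟩
  q               ≡⟨ ℚ.*-identityʳ q ⟨
  q ℚ.* 1ℚ
    ≤⟨ ℚ.*-monoˡ-≤-nonNeg q ⦃ ℚ.nonNegative (ℚ.≤-trans (fromℕ-mono {0} {1} z≤n) 1≤q) ⦄ (^ℚ-mono {n = n} 1≤q z≤n) ⟩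
  q ℚ.* q ^ℚ n    ∎
  where open ℚ.≤-Reasoning
^ℚ-mono {q} 1≤q (s≤s m≤n) =
  ℚ.*-monoˡ-≤-nonNeg q ⦃ ℚ.nonNegative (ℚ.≤-trans (fromℕ-mono {0} {1} z≤n) 1≤q) ⦄ (^ℚ-mono 1≤q m≤n)

-- Wrapping the bound in a record keeps conversion checking from unfolding
-- rational arithmetic.
infix 4 _≤[_,_]_
record _≤[_,_]_ (t : ℕ) (c : ℝ≥0) (n a : ℕ) : Set where
  constructor bounded
  field
    bound : t ≤ a · c ^ᴿ n

open _≤[_,_]_ public

-- Raising the exponent from `m` to `n` is sound because every `q` above `c` is at least 1.
≤[]-mono : ∀ {c t a b m n} → 1≤ᴿ c → a ≤ b → m ≤ n → t ≤[ c , m ] a → t ≤[ c , n ] b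
≤[]-mono {c} {t} {a} {b} {m} {n} 1≤c a≤b m≤n (bounded t≤) = bounded λ {q} c<q → begin
  fromℕ t                ≤⟨ t≤ c<q ⟩
  fromℕ a ℚ.* q ^ℚ m
    ≤⟨ ℚ.*-monoˡ-≤-nonNeg (fromℕ a) ⦃ fromℕ-nonNeg a ⦄ (^ℚ-mono (1≤c c<q) m≤n) ⟩
  fromℕ a ℚ.* q ^ℚ n
    ≤⟨ ℚ.*-monoʳ-≤-nonNeg (q ^ℚ n) ⦃ ℚ.nonNegative (ℚ.≤-trans (fromℕ-mono {0} {1} z≤n) (^ℚ-mono (1≤c c<q) (z≤n {n}))) ⦄ (fromℕ-mono a≤b) ⟩
  fromℕ b ℚ.* q ^ℚ n     ∎
  where open ℚ.≤-Reasoning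

≤⇒≤[] : ∀ {c n t a} → 1≤ᴿ c → t ≤ a → t ≤[ c , n ] a
≤⇒≤[] {c} {n} {t} 1≤c t≤a =
  ≤[]-mono 1≤c t≤a z≤n (bounded {t} {c} {0} {t} λ _ → ℚ.≤-reflexive (sym (ℚ.*-identityʳ (fromℕ t))))

≤-≤[]-trans : ∀ {c n t u a} → t ≤ u → u ≤[ c , n ] a → t ≤[ c , n ] a
≤-≤[]-trans t≤u (bounded u≤) = bounded λ c<q → ℚ.≤-trans (fromℕ-mono t≤u) (u≤ c<q)

≤[]-+ : ∀ {c n t u a b} → t ≤[ c , n ] a → u ≤[ c , n ] b → t + u ≤[ c , n ] a + b
≤[]-+ {c} {n} {t} {u} {a} {b} (bounded t≤) (bounded u≤) = bounded λ {q} c<q → begin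
  fromℕ (t + u)                                    ≡⟨ fromℕ-+ t u ⟩
  fromℕ t ℚ.+ fromℕ u                              ≤⟨ ℚ.+-mono-≤ (t≤ c<q) (u≤ c<q) ⟩
  fromℕ a ℚ.* q ^ℚ n ℚ.+ fromℕ b ℚ.* q ^ℚ n        ≡⟨ ℚ.*-distribʳ-+ (q ^ℚ n) (fromℕ a) (fromℕ b) ⟨
  (fromℕ a ℚ.+ fromℕ b) ℚ.* q ^ℚ n                 ≡⟨ cong (ℚ._* q ^ℚ n) (fromℕ-+ a b) ⟨
  fromℕ (a + b) ℚ.* q ^ℚ n                         ∎
  where open ℚ.≤-Reasoning

-- Polynomials and monomials.

⟪⟫≤monomial : ∀ p x .⦃ _ : NonZero x ⦄ → p ⟪ x ⟫ ≤ sum p * x ^ length p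
⟪⟫≤monomial []      x = z≤n
⟪⟫≤monomial (a ∷ p) x = begin
  a + x * p ⟪ x ⟫
    ≤⟨ +-mono-≤ (m≤m*n a (x * X) ⦃ m^n≢0 x (suc (length p)) ⦄) (*-monoʳ-≤ x (⟪⟫≤monomial p x)) ⟩
  a * (x * X) + x * (sum p * X)                    ≡⟨ expand a (sum p) x X ⟩
  (a + sum p) * (x * X)                            ∎
  where
  open ≤-Reasoning
  X = x ^ length p
  expand : ∀ a s x y → a * (x * y) + x * (s * y) ≡ (a + s) * (x * y)
  expand = solve-∀

monomial : ℕ → ℕ → Polynomial
monomial A d = List.replicate d 0 ++ [ A ]

monomial-⟪⟫ : ∀ A d x → monomial A d ⟪ x ⟫ ≡ A * x ^ d
monomial-⟪⟫ A zero    x = trans (cong (λ y → A + y) (*-zeroʳ x)) (trans (+-identityʳ A) (sym (*-identityʳ A)))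
monomial-⟪⟫ A (suc d) x = trans (cong (x *_) (monomial-⟪⟫ A d x)) (expand A x (x ^ d))
  where
  expand : ∀ A x y → x * (A * y) ≡ A * (x * y)
  expand = solve-∀

-- WHILE programs calling another program

private
  variable
    k l : ℕ

renameᴱ : (Fin k → Fin l) → Expr k → Expr l
renameᴱ f (var x)    = var (f x)
renameᴱ f nil        = nil
renameᴱ f (cons d e) = cons (renameᴱ f d) (renameᴱ f e)
renameᴱ f (hd e)     = hd (renameᴱ f e)
renameᴱ f (tl e)     = tl (renameᴱ f e)

rename : (Fin k → Fin l) → Command k → Command l
rename f (x := e)    = f x := renameᴱ f e
rename f (C ⨾ D)     = rename f C ⨾ rename f D
rename f (while e C) = while (renameᴱ f e) (rename f C)

cost-rename : (f : Fin k → Fin l) (e : Expr k) → cost (renameᴱ f e) ≡ cost e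
cost-rename f (var x)    = refl
cost-rename f nil        = refl
cost-rename f (cons d e) = cong suc (cong₂ _+_ (cost-rename f d) (cost-rename f e))
cost-rename f (hd e)     = cong suc (cost-rename f e)
cost-rename f (tl e)     = cong suc (cost-rename f e)

-- One interface for every way of placing the variables of a program in a larger store. The other
-- contents are frozen into `store`, so a run transfers with its time unchanged.
record Embedding (k l : ℕ) : Set where
  field
    index  : Fin k → Fin l
    store  : Store k → Store l
    lookup-store : ∀ s x → lookup (store s) (index x) ≡ lookup s x
    update-store : ∀ s x v → store s [ index x ]≔ v ≡ store (s [ x ]≔ v)

  eval-rename : ∀ e s → eval (renameᴱ index e) (store s) ≡ eval e s
  eval-rename (var x)    s = lookup-store s x
  eval-rename nil        s = refl
  eval-rename (cons d e) s = cong₂ cons (eval-rename d s) (eval-rename e s)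
  eval-rename (hd e)     s = cong hdᵀ (eval-rename e s)
  eval-rename (tl e)     s = cong tlᵀ (eval-rename e s)

  run-rename : ∀ {C s s′ t} → ⟨ C , s ⟩⇓ s′ [ t ] → ⟨ rename index C , store s ⟩⇓ store s′ [ t ]
  run-rename (assign {x} {e} {s})
    rewrite sym (update-store s x (eval e s)) | sym (eval-rename e s) | sym (cost-rename index e) = assign
  run-rename (seq r₁ r₂) = seq (run-rename r₁) (run-rename r₂)
  run-rename (stop {e} {s = s} e≡nil)
    rewrite sym (cost-rename index e) = stop (trans (eval-rename e s) e≡nil)
  run-rename (loop {e} {s = s} e≢nil r₁ r₂)
    with r₂′ ← run-rename r₂
    rewrite sym (cost-rename index e) =
    loop (λ e≡nil → e≢nil (trans (sym (eval-rename e s)) e≡nil)) (run-rename r₁) r₂′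

-- Allows the stored value to be known only up to a proof, as for `literal`, whose evaluation does
-- not reduce for a variable tree.
assign′ : ∀ {x : Fin k} {e s v} → eval e s ≡ v → ⟨ x := e , s ⟩⇓ s [ x ]≔ v [ suc (cost e) ]
assign′ refl = assign

run-cong : ∀ {C : Command k} {s₁ s₂ s′ t} → s₁ ≡ s₂ → ⟨ C , s₂ ⟩⇓ s′ [ t ] → ⟨ C , s₁ ⟩⇓ s′ [ t ]
run-cong refl r = r

1≤time : ∀ {C : Command k} {s s′ t} → ⟨ C , s ⟩⇓ s′ [ t ] → 1 ≤ t
1≤time assign        = s≤s z≤n
1≤time (seq r₁ r₂)   = m≤n⇒m≤n+o _ (1≤time r₁)
1≤time (stop _)      = s≤s z≤n
1≤time (loop _ _ _)  = s≤s z≤n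

-- `nil` is the only constant of the language. The codes of the names of `｛0｝` and `｛1｝` are spelled
-- out in the program, so their cost does not depend on the instance.
literal : Tree → Expr k
literal nil        = nil
literal (cons a b) = cons (literal a) (literal b)

eval-literal : ∀ d (s : Store k) → eval (literal d) s ≡ d
eval-literal nil        s = refl
eval-literal (cons a b) s = cong₂ cons (eval-literal a s) (eval-literal b s)

cons-embedding : Tree → Embedding k (suc k)
cons-embedding v = record
  { index = suc
  ; store = v ∷_
  ; lookup-store = λ _ _ → refl
  ; update-store = λ _ _ _ → refl
  }

++-embedding : Store l → Embedding k (k + l)
++-embedding {l} f = record
  { index = _↑ˡ l
  ; store = Vec._++ f
  ; lookup-store = λ s → lookup-++ˡ s f
  ; update-store = λ s x v → []≔-++-↑ˡ s f x
  }

-- The reduction's store consists of the oracle's store followed by three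
-- variables of its own. The oracle's first variable is shared, so that the
-- reduction sees itself as a program in four variables.
skip-index : ∀ k → Fin (suc l) → Fin (suc (k + l))
skip-index k zero    = zero
skip-index k (suc x) = suc (k ↑ʳ x)

skip-embedding : Store k → Embedding (suc l) (suc (k + l))
skip-embedding {k} {l} vs = record
  { index = skip-index k
  ; store = λ { (v ∷ f) → v ∷ (vs Vec.++ f) }
  ; lookup-store = λ { (v ∷ f) zero → refl ; (v ∷ f) (suc x) → lookup-++ʳ vs f x }
  ; update-store = λ { (v ∷ f) zero w → refl ; (v ∷ f) (suc x) w → cong (v ∷_) ([]≔-++-↑ʳ vs f x) }
  }

-- The oracle is only specified on auxiliary variables that are `nil`, so its store is reset before
-- every call.
clear : ∀ k → Command (suc k)
clear zero    = zero := nil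
clear (suc k) = zero := nil ⨾ rename suc (clear k)

clear-time : ℕ → ℕ
clear-time zero    = 2
clear-time (suc k) = 2 + clear-time k

run-clear : ∀ (s : Store (suc k)) → ⟨ clear k , s ⟩⇓ Vec.replicate (suc k) nil [ clear-time k ]
run-clear {zero}  (v ∷ [])    = assign
run-clear {suc k} (v ∷ s)     = seq assign (Embedding.run-rename (cons-embedding nil) (run-clear s))

replicate-++ : ∀ {a} {A : Set a} m n {x : A} →
  Vec.replicate (m + n) x ≡ Vec.replicate m x Vec.++ Vec.replicate n x
replicate-++ zero    n = refl
replicate-++ (suc m) n = cong (_ ∷_) (replicate-++ m n)

-- The value of `encodeConstraint` for a unary constraint whose name has code `d` and whose argument
-- has code `x`.
unit : Tree → Tree → Tree
unit d x = cons d (cons x nil)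

unitᴱ : Tree → Expr k → Expr k
unitᴱ d e = cons (literal d) (cons e nil)

eval-unit : ∀ d (e : Expr k) s → eval (unitᴱ d e) s ≡ unit d (eval e s)
eval-unit d e s = cong (λ d → unit d (eval e s)) (eval-literal d s)

-- The reduction as a program, with its running time.

pattern input = zero
pattern theory = suc zero
pattern rest  = suc (suc zero)
pattern answer = suc (suc (suc zero))

addUnits : Tree → List Tree → Tree → Tree
addUnits d []       B = B
addUnits d (x ∷ xs) B = addUnits d xs (cons (unit d x) B)

assumeStep : Tree → Command 4
assumeStep d = theory := cons (unitᴱ d (hd (var rest))) (var theory) ⨾ rest := tl (var rest)

assume : Tree → Command 4
assume d = while (var rest) (assumeStep d)

-- One round of the loop: 2 for the test, then the push onto `theory`, then 3 for advancing `rest`.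
-- The final test is paid for by the additional round in `suc (length xs)`.
assumeTime : Tree → ℕ
assumeTime d = 2 + (suc (cost {4} (cons (unitᴱ d (hd (var rest))) (var theory))) + 3)

run-assume : ∀ d xs {w B r} → ∃ λ t →
  ⟨ assume d , w ∷ B ∷ list xs ∷ r ∷ [] ⟩⇓ w ∷ addUnits d xs B ∷ nil ∷ r ∷ [] [ t ] ×
  t ≤ suc (length xs) * assumeTime d
run-assume d [] = 2 , stop refl , s≤s (s≤s z≤n)
run-assume d (x ∷ xs) with t , r , t≤ ← run-assume d xs =
  _ , loop (λ ()) (seq (assign′ (cong₂ cons (eval-unit d (hd (var rest)) _) refl)) assign) r ,
  (begin
    2 + (_ + t)                                       ≡⟨ +-assoc 2 _ t ⟨
    assumeTime d + t                                  ≤⟨ +-monoʳ-≤ (assumeTime d) t≤ ⟩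
    suc (suc (length xs)) * assumeTime d              ∎)
  where open ≤-Reasoning

prepare : Tree → Command 4
prepare d =
  theory := hd (var input) ⨾
  rest := hd (tl (var input)) ⨾
  assume d ⨾
  rest := tl (tl (var input)) ⨾
  answer := cons nil nil

run-prepare : ∀ d {B xs ys v₁ v₂ v₃} → ∃ λ t →
  let w = cons B (cons (list xs) ys) in
  ⟨ prepare d , w ∷ v₁ ∷ v₂ ∷ v₃ ∷ [] ⟩⇓ w ∷ addUnits d xs B ∷ ys ∷ cons nil nil ∷ [] [ t ] ×
  t ≤ suc (length xs) * assumeTime d + 15
run-prepare d {xs = xs} with t , r , t≤ ← run-assume d xs =
  _ , seq assign (seq assign (seq r (seq assign assign))) ,
  (begin
    3 + (4 + (t + (4 + 4)))               ≡⟨ +-comm 7 (t + 8) ⟩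
    t + 8 + 7                             ≡⟨ +-assoc t 8 7 ⟩
    t + 15                                ≤⟨ +-monoˡ-≤ 15 t≤ ⟩
    suc (length xs) * assumeTime d + 15   ∎)
  where open ≤-Reasoning

module Oracle (P : Program) (d₀ : Tree) where
  open Program P

  own : Command 4 → Command (suc (auxiliary + 3))
  own = rename (skip-index auxiliary)

  oracle : Command (suc auxiliary) → Command (suc (auxiliary + 3))
  oracle = rename (_↑ˡ 3)

  ask : Command 4
  ask = input := cons (unitᴱ d₀ (hd (var rest))) (var theory)

  -- A conditional: the loop clears its own guard and so runs at most once.
  refuteIfSat : Command 4
  refuteIfSat = while (var input) (answer := nil ⨾ input := nil)

  call : Command (suc (auxiliary + 3))
  call = oracle (clear auxiliary) ⨾ own ask ⨾ oracle body ⨾ own (refuteIfSat ⨾ rest := tl (var rest))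

  -- The constant 11 is at most 8 for `refuteIfSat` plus 3 for advancing `rest`. The time of the
  -- oracle itself is accounted for separately.
  callTime : ℕ
  callTime = clear-time auxiliary + suc (cost {4} (cons (unitᴱ d₀ (hd (var rest))) (var theory))) + 11

  run-refuteIfSat : ∀ b r {B xs} → ∃ λ t →
    ⟨ refuteIfSat , bool b ∷ B ∷ xs ∷ bool r ∷ [] ⟩⇓ nil ∷ B ∷ xs ∷ bool (not b Bool.∧ r) ∷ [] [ t ] × t ≤ 8
  run-refuteIfSat false r = 2 , stop refl , s≤s (s≤s z≤n)
  run-refuteIfSat true  r = 8 , loop (λ ()) (seq assign assign) (stop refl) , ≤-refl

  -- The oracle may leave anything in its variables, hence the unspecified `s′`; the next call
  -- accepts it because `s` is arbitrary and is cleared first.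
  run-call : ∀ {s B x xs r b t} → P on cons (unit d₀ x) B ⇒ bool b [ t ] →
    ∃₂ λ (s′ : Store (suc auxiliary)) t′ →
    ⟨ call , s Vec.++ B ∷ cons x xs ∷ bool r ∷ [] ⟩⇓ s′ Vec.++ B ∷ xs ∷ bool (not b Bool.∧ r) ∷ [] [ t′ ] ×
    t′ ≤ t + callTime
  run-call {s} {B} {x} {xs} {r} {b} {t} ((_ ∷ vs) , body⇓ , refl)
    with u , refute⇓ , u≤8 ← run-refuteIfSat b r {B} {cons x xs} =
    nil ∷ vs , _ ,
    seq (run-rename (++-embedding _) (run-clear s))
      (seq (run-rename (skip-embedding (Vec.replicate auxiliary nil))
             (assign′ (cong₂ cons (eval-unit d₀ (hd (var rest)) _) refl)))
        (seq (run-rename (++-embedding _) body⇓)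
          (run-rename (skip-embedding vs) (seq refute⇓ assign)))) ,
    (begin
      clear-time auxiliary + (α + (t + (u + 3)))
        ≤⟨ +-monoʳ-≤ (clear-time auxiliary) (+-monoʳ-≤ α (+-monoʳ-≤ t (+-monoˡ-≤ 3 u≤8))) ⟩
      clear-time auxiliary + (α + (t + 11))         ≡⟨ shuffle (clear-time auxiliary) α t ⟩
      t + callTime                          ∎)
    where
    open ≤-Reasoning
    open Embedding
    α = suc (cost {4} (cons (unitᴱ d₀ (hd (var rest))) (var theory)))
    shuffle : ∀ a b t → a + (b + (t + 11)) ≡ t + (a + b + 11)
    shuffle = solve-∀

  search : Command (suc (auxiliary + 3))
  search = while (var (skip-index auxiliary rest)) call

  lookup-rest : ∀ (s : Store (suc auxiliary)) {B xs r} →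
    lookup (s Vec.++ B ∷ xs ∷ r ∷ []) (skip-index auxiliary rest) ≡ xs
  lookup-rest (w ∷ vs) {B} {xs} {r} = Embedding.lookup-store (skip-embedding vs) (w ∷ B ∷ xs ∷ r ∷ []) rest

  program : Tree → Program
  program d₁ = record { body = own (prepare d₁) ⨾ search ⨾ own (input := var answer) }

  module _ {c : ℝ≥0} (1≤c : 1≤ᴿ c) {a n : ℕ} {ℓ : Level} {S : Var → Set ℓ} {B : Tree} where

    -- The loop is analysed for an abstract property `S` decided by the oracle; satisfiability of
    -- the queries is substituted for it later. The bound is the same for all `x`, so the costs of
    -- the calls can be added.
    Answered : Var → Set ℓ
    Answered x = ∃₂ λ b t →
      P on cons (unit d₀ (encodeVar x)) B ⇒ bool b [ t ] × Reflects (S x) b × t ≤[ c , n ] a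

    searchBound : ℕ → ℕ
    searchBound m = suc m * (a + (2 + callTime))

    -- The flag `r` records whether all variables handled so far were refuted, so the invariant is
    -- the conjunction of `r` with the refutation of those that remain.
    run-search : ∀ {xs} → All Answered xs → ∀ r (s : Store (suc auxiliary)) →
      ∃₂ λ (s′ : Store (suc auxiliary)) r′ → ∃ λ t →
      ⟨ search , s Vec.++ B ∷ encodeVars xs ∷ bool r ∷ [] ⟩⇓ s′ Vec.++ B ∷ nil ∷ bool r′ ∷ [] [ t ] ×
      Reflects (T r × All (λ x → ¬ S x) xs) r′ × t ≤[ c , n ] searchBound (length xs)
    run-search [] r s =
      s , r , 2 , stop (lookup-rest s) , reflects r , ≤⇒≤[] 1≤c 2≤
      where
      2≤ : 2 ≤ searchBound 0
      2≤ = m≤n⇒m≤n+o 0 (m≤n⇒m≤o+n a (m≤m+n 2 callTime))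
      reflects : ∀ r → Reflects (T r × All (λ x → ¬ S x) []) r
      reflects false = ofⁿ λ ()
      reflects true  = ofʸ (tt , [])
    run-search {x ∷ xs} ((b , t , P⇓ , S? , t≤) ∷ answered) r s
      with s₁ , t₁ , call⇓ , t₁≤ ← run-call {s} {xs = encodeVars xs} {r = r} P⇓
      with s₂ , r′ , t₂ , search⇓ , r′-reflects , t₂≤ ← run-search answered (not b Bool.∧ r) s₁ =
      s₂ , r′ , _ ,
      loop (λ eq → cons≢nil (trans (sym (lookup-rest s)) eq)) call⇓ search⇓ ,
      reflects S? r r′-reflects ,
      subst (λ u → u ≤[ c , n ] searchBound (length (x ∷ xs))) (+-assoc 2 t₁ t₂)
        (≤[]-+ step≤ t₂≤)
      where
      cons≢nil : ∀ {y ys} → Tree.cons y ys ≢ nil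
      cons≢nil ()
      step≤ : 2 + t₁ ≤[ c , n ] a + (2 + callTime)
      step≤ = ≤-≤[]-trans
        (≤-trans (+-monoʳ-≤ 2 t₁≤) (≤-reflexive (shuffle t callTime)))
        (≤[]-+ t≤ (≤⇒≤[] 1≤c ≤-refl))
        where
        shuffle : ∀ t u → 2 + (t + u) ≡ t + (2 + u)
        shuffle = solve-∀
      -- If `S x` holds, the flag passed on is false, so the rest of the loop cannot return true and
      -- that case is empty.
      reflects : ∀ {b r′} → Reflects (S x) b → ∀ r →
        Reflects (T (not b Bool.∧ r) × All (λ x → ¬ S x) xs) r′ →
        Reflects (T r × All (λ x → ¬ S x) (x ∷ xs)) r′
      reflects (ofⁿ ¬Sx) r (ofʸ (Tr , all)) = ofʸ (Tr , ¬Sx ∷ all)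
      reflects (ofⁿ ¬Sx) r (ofⁿ ¬all)       = ofⁿ λ { (Tr , _ ∷ all) → ¬all (Tr , all) }
      reflects (ofʸ Sx)  r (ofⁿ _)          = ofⁿ λ { (_ , ¬Sx ∷ _) → ¬Sx Sx }

    run-program : ∀ d₁ {φ hs xs} → B ≡ addUnits d₁ hs φ → All Answered xs → ∃₂ λ b t →
      program d₁ on cons φ (cons (list hs) (encodeVars xs)) ⇒ bool b [ t ] ×
      Reflects (All (λ x → ¬ S x) xs) b ×
      t ≤[ c , n ] suc (length hs) * assumeTime d₁ + 15 + (searchBound (length xs) + 2)
    run-program d₁ {φ} {hs} {xs} refl answered
      with t₁ , prepare⇓ , t₁≤ ← run-prepare d₁ {φ} {hs} {encodeVars xs} {nil} {nil} {nil}
      with (w ∷ vs) , b , t₂ , search⇓ , reflects , t₂≤ ← run-search answered true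
        (cons φ (cons (list hs) (encodeVars xs)) ∷ Vec.replicate auxiliary nil) =
      b , _ ,
      -- The initial block of `nil`s is split into the oracle's auxiliary variables and the three of
      -- the reduction.
      (_ , seq (run-cong (cong (_ ∷_) (replicate-++ auxiliary 3))
                 (run-rename (skip-embedding (Vec.replicate auxiliary nil)) prepare⇓))
             (seq search⇓ (run-rename (skip-embedding vs) assign)) , refl) ,
      drop-T reflects ,
      ≤[]-+ (≤⇒≤[] 1≤c t₁≤) (≤[]-+ t₂≤ (≤⇒≤[] 1≤c ≤-refl))
      where
      open Embedding
      drop-T : ∀ {b} {A : Set ℓ} → Reflects (T true × A) b → Reflects A b
      drop-T (ofʸ (_ , a)) = ofʸ a
      drop-T (ofⁿ ¬a)      = ofⁿ λ a → ¬a (tt , a)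

-- From abduction to satisfiability

size-nonZero : ∀ d → NonZero (size d)
size-nonZero nil        = _
size-nonZero (cons _ _) = _

-- Crude but sufficient for a polynomial bound: a digit adds at most 4 to the size and raises the
-- value by at least 1.
size-encodeBinary : ∀ b → size (encodeBinary b) ≤ 1 + 4 * ℕᵇ.toℕ b
size-encodeBinary ℕᵇ.zero  = ≤-refl
size-encodeBinary 2[1+ b ] = begin
  2 + size (encodeBinary b)           ≤⟨ +-monoʳ-≤ 2 (size-encodeBinary b) ⟩
  2 + (1 + 4 * ℕᵇ.toℕ b)              ≤⟨ m≤m+n _ (6 + 4 * ℕᵇ.toℕ b) ⟩
  2 + (1 + 4 * ℕᵇ.toℕ b) + (6 + 4 * ℕᵇ.toℕ b) ≡⟨ expand (ℕᵇ.toℕ b) ⟩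
  1 + 4 * (2 * suc (ℕᵇ.toℕ b))        ∎
  where
  open ≤-Reasoning
  expand : ∀ n → 2 + (1 + 4 * n) + (6 + 4 * n) ≡ 1 + 4 * (2 * suc n)
  expand = solve-∀
size-encodeBinary 1+[2 b ] = begin
  4 + size (encodeBinary b)           ≤⟨ +-monoʳ-≤ 4 (size-encodeBinary b) ⟩
  4 + (1 + 4 * ℕᵇ.toℕ b)              ≤⟨ m≤m+n _ (4 * ℕᵇ.toℕ b) ⟩
  4 + (1 + 4 * ℕᵇ.toℕ b) + 4 * ℕᵇ.toℕ b ≡⟨ expand (ℕᵇ.toℕ b) ⟩
  1 + 4 * suc (2 * ℕᵇ.toℕ b)          ∎
  where
  open ≤-Reasoning
  expand : ∀ n → 4 + (1 + 4 * n) + 4 * n ≡ 1 + 4 * suc (2 * n)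
  expand = solve-∀

size-encodeVar : ∀ x → size (encodeVar x) ≤ 1 + 4 * x
size-encodeVar x =
  subst (λ y → size (encodeVar x) ≤ 1 + 4 * y) (ℕᵇ.toℕ-fromℕ x) (size-encodeBinary (ℕᵇ.fromℕ x))

length<size-encodeVars : ∀ xs → suc (length xs) ≤ size (encodeVars xs)
length<size-encodeVars []       = ≤-refl
length<size-encodeVars (x ∷ xs) = s≤s (m≤n⇒m≤o+n (size (encodeVar x)) (length<size-encodeVars xs))

size-∈ : ∀ {x xs} → x ∈ xs → size (encodeVar x) ≤ size (encodeVars xs)
size-∈ {x} (here refl)            = m≤n⇒m≤1+n (m≤m+n (size (encodeVar x)) _)
size-∈ {xs = y ∷ _} (there x∈xs)  = m≤n⇒m≤1+n (m≤n⇒m≤o+n (size (encodeVar y)) (size-∈ x∈xs))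

⟪⟫≤ : ∀ p {x y} .⦃ _ : NonZero x ⦄ → x ≤ y → p ⟪ x ⟫ ≤ sum p * y ^ length p
⟪⟫≤ p {x} x≤y = ≤-trans (⟪⟫≤monomial p x) (*-monoʳ-≤ (sum p) (^-monoˡ-≤ (length p) x≤y))

module Reduction {ℓ} (ρ : Representation) (Γ : Language ℓ) where
  open Representation ρ
  open Constraint

  name₀ name₁ : Name 1
  name₀ = proj₁ (complete ｛0｝)
  name₁ = proj₁ (complete ｛1｝)

  fact denial : Var → Constraint ρ (Γ ⁺)
  fact x   = record { name = name₁ ; args = x ∷ [] ; name∈Γ = isTrue (proj₂ (complete ｛1｝)) }
  denial x = record { name = name₀ ; args = x ∷ [] ; name∈Γ = isFalse (proj₂ (complete ｛0｝)) }

  embed : Constraint ρ Γ → Constraint ρ (Γ ⁺)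
  embed C = record { name = name C ; args = args C ; name∈Γ = base (name∈Γ C) }

  assuming : List Var → Formula ρ (Γ ⁺) → Formula ρ (Γ ⁺)
  assuming []       φ = φ
  assuming (h ∷ hs) φ = assuming hs (fact h ∷ φ)

  -- Both recursions push the facts one by one onto an accumulator, in the order of the program's
  -- loop, so nothing has to be reversed.
  encode-assuming : ∀ hs φ →
    encodeFormula (assuming hs φ) ≡ addUnits (code name₁) (map encodeVar hs) (encodeFormula φ)
  encode-assuming []       φ = refl
  encode-assuming (h ∷ hs) φ = encode-assuming hs (fact h ∷ φ)

  encode-embed : ∀ φ → encodeFormula (map embed φ) ≡ encodeFormula φ
  encode-embed []      = refl
  encode-embed (C ∷ φ) = cong (cons (encodeConstraint C)) (encode-embed φ)

  vars-embed : ∀ φ → vars (map embed φ) ≡ vars φ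
  vars-embed []      = refl
  vars-embed (C ∷ φ) = cong (Vec.toList (args C) ++_) (vars-embed φ)

  vars-fact : ∀ xs → vars (map fact xs) ≡ xs
  vars-fact []       = refl
  vars-fact (x ∷ xs) = cong (x ∷_) (vars-fact xs)

  vars-assuming : ∀ hs {φ x} → x ∈ vars (assuming hs φ) → x ∈ vars φ ⊎ x ∈ hs
  vars-assuming []       x∈ = inj₁ x∈
  vars-assuming (h ∷ hs) x∈ with vars-assuming hs x∈
  ... | inj₁ (here eq)  = inj₂ (here eq)
  ... | inj₁ (there x∈φ) = inj₁ x∈φ
  ... | inj₂ x∈hs       = inj₂ (there x∈hs)

  ⊨-assuming⁺ : ∀ {σ} hs {φ} → σ ⊨ φ ∧ hs → σ ⊨ assuming hs φ
  ⊨-assuming⁺ []       (σ⊨φ , [])       = σ⊨φ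
  ⊨-assuming⁺ (h ∷ hs) (σ⊨φ , σh ∷ σhs) =
    ⊨-assuming⁺ hs (trans (proj₂ (complete ｛1｝) _) σh ∷ σ⊨φ , σhs)

  ⊨-assuming⁻ : ∀ {σ} hs {φ} → σ ⊨ assuming hs φ → σ ⊨ φ ∧ hs
  ⊨-assuming⁻ []       σ⊨φ = σ⊨φ , []
  ⊨-assuming⁻ (h ∷ hs) σ⊨  with σh ∷ σ⊨φ , σhs ← ⊨-assuming⁻ hs σ⊨ =
    σ⊨φ , trans (sym (proj₂ (complete ｛1｝) _)) σh ∷ σhs

  -- The denial stands in front so that the remaining formula is built once and shared by all `m`.
  query : AbductionInstance ρ Γ → Var → Formula ρ (Γ ⁺)
  query I m = denial m ∷ assuming H (map embed KB)
    where open AbductionInstance I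

  Sat : Formula ρ (Γ ⁺) → Set ℓ
  Sat = Problem.Yes (SAT ρ (Γ ⁺))

  module _ (I : AbductionInstance ρ Γ) where
    open AbductionInstance I

    query-sat : ∀ {σ m} → σ ⊨ KB ∧ H → σ m ≡ false → Sat (query I m)
    query-sat {σ} (σ⊨KB , σH) σm =
      σ , trans (proj₂ (complete ｛0｝) _) (cong not σm) ∷ ⊨-assuming⁺ H (All.map⁺ σ⊨KB , σH)

    query-sat⁻ : ∀ {m} → Sat (query I m) → ∃ λ σ → σ ⊨ KB ∧ H × σ m ≡ false
    query-sat⁻ {m} (σ , ¬σm ∷ σ⊨) with σ⊨KB , σH ← ⊨-assuming⁻ H σ⊨ =
      σ , (All.map⁻ σ⊨KB , σH) , not-true (trans (sym (proj₂ (complete ｛0｝) _)) ¬σm)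
      where
      not-true : ∀ {b} → not b ≡ true → b ≡ false
      not-true {false} _ = refl

    all-refuted⇒explanation : OneValid Γ → All (λ m → ¬ Sat (query I m)) M → ∃ (Explanation I)
    all-refuted⇒explanation 1-valid unsat =
      H , (λ x∈H → x∈H) , ((λ _ → true) , All.universal ones KB , All.universal (λ _ → refl) H) ,
      All.map entailed unsat
      where
      map-const : ∀ {k} (xs : Vec Var k) → Vec.map (λ _ → true) xs ≡ Vec.replicate k true
      map-const []       = refl
      map-const (_ ∷ xs) = cong (true ∷_) (map-const xs)
      -- The consistency of `KB` with `H`, and the place where 1-validity enters.
      ones : ∀ C → ⟦ name C ⟧ (Vec.map (λ _ → true) (args C)) ≡ true
      ones C = trans (cong ⟦ name C ⟧ (map-const (args C))) (1-valid (name∈Γ C))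
      entailed : ∀ {m} → ¬ Sat (query I m) → ∀ σ → σ ⊨ KB ∧ H → σ m ≡ true
      entailed {m} ¬sat σ σ⊨ with σ m in σm
      ... | true  = refl
      ... | false = contradiction (query-sat σ⊨ σm) ¬sat

    -- Since `E ⊆ H`, a model of `KB ∧ H ∧ ¬m` would be a model of `KB ∧ E` falsifying `m`.
    explanation⇒all-refuted : ∃ (Explanation I) → All (λ m → ¬ Sat (query I m)) M
    explanation⇒all-refuted (E , E⊆H , _ , entails) = All.map refuted entails
      where
      refuted : ∀ {m} → (∀ σ → σ ⊨ KB ∧ E → σ m ≡ true) → ¬ Sat (query I m)
      refuted entailed sat with σ , (σ⊨KB , σH) , σm ← query-sat⁻ sat
        with () ← trans (sym (entailed σ (σ⊨KB , All.tabulate (All.lookup σH ∘ E⊆H)))) σm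

    -- The denied variable comes from `M`, so it is already counted in the instance.
    #vars-query : ∀ {m} → m ∈ M → #distinct (vars (query I m)) ≤ #distinct (vars KB ++ H ++ M)
    #vars-query {m} m∈M = #distinct-mono λ where
      (here refl) → ∈-++⁺ʳ (vars KB) (∈-++⁺ʳ H m∈M)
      (there x∈)  → Sum.[ (λ x∈KB → ∈-++⁺ˡ (subst (_ ∈_) (vars-embed KB) x∈KB))
                        , (λ x∈H → ∈-++⁺ʳ (vars KB) (∈-++⁺ˡ x∈H)) ] (vars-assuming H x∈)

  -- Sizes of the queries.

  κ₀ κ₁ κ : ℕ
  κ₀ = size (code name₀)
  κ₁ = size (code name₁)
  -- A unit constraint in a formula takes three `cons` and one `nil` besides the codes of its name
  -- and its variable; one constant serves both names.
  κ  = 4 + κ₀ + κ₁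

  size-assuming : ∀ hs φ →
    size (encodeFormula (assuming hs φ)) ≤ size (encodeFormula φ) + κ * size (encodeVars hs)
  size-assuming []       φ = m≤m+n _ _
  size-assuming (h ∷ hs) φ = begin
    size (encodeFormula (assuming hs (fact h ∷ φ)))    ≤⟨ size-assuming hs (fact h ∷ φ) ⟩
    suc (suc (κ₁ + suc (x + 1)) + f) + κ * y           ≤⟨ m≤m+n _ _ ⟩
    suc (suc (κ₁ + suc (x + 1)) + f) + κ * y + (κ₀ + (3 + κ₀ + κ₁) * x) ≡⟨ expand κ₀ κ₁ x y f ⟩
    f + κ * suc (x + y)                                ∎
    where
    open ≤-Reasoning
    x = size (encodeVar h)
    y = size (encodeVars hs)
    f = size (encodeFormula φ)
    expand : ∀ k₀ k₁ x y f →
      suc (suc (k₁ + suc (x + 1)) + f) + (4 + k₀ + k₁) * y + (k₀ + (3 + k₀ + k₁) * x)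
      ≡ f + (4 + k₀ + k₁) * suc (x + y)
    expand = solve-∀

  size-query : ∀ I {m} → m ∈ AbductionInstance.M I →
    size (encodeFormula (query I m)) ≤ κ * size (Problem.encode (P-ABD ρ Γ) I)
  size-query I {m} m∈M = begin
    suc (suc (κ₀ + suc (x + 1)) + size (encodeFormula (assuming H (map embed KB))))
      ≤⟨ s≤s (+-mono-≤ (s≤s (+-monoʳ-≤ κ₀ (s≤s (+-monoˡ-≤ 1 (size-∈ m∈M))))) (size-assuming H (map embed KB))) ⟩
    suc (suc (κ₀ + suc (z + 1)) + (size (encodeFormula (map embed KB)) + κ * y))
      ≡⟨ cong (λ d → suc (suc (κ₀ + suc (z + 1)) + (size d + κ * y))) (encode-embed KB) ⟩
    suc (suc (κ₀ + suc (z + 1)) + (f + κ * y))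
      ≤⟨ m≤m+n _ _ ⟩
    suc (suc (κ₀ + suc (z + 1)) + (f + κ * y)) + (κ + κ₁ + (3 + κ₀ + κ₁) * (z + f))
      ≡⟨ expand κ₀ κ₁ y z f ⟩
    κ * suc (f + suc (y + z)) ∎
    where
    open AbductionInstance I
    open ≤-Reasoning
    x = size (encodeVar m)
    y = size (encodeVars H)
    z = size (encodeVars M)
    f = size (encodeFormula KB)
    expand : ∀ k₀ k₁ y z f →
      suc (suc (k₀ + suc (z + 1)) + (f + (4 + k₀ + k₁) * y)) + (4 + k₀ + k₁ + k₁ + (3 + k₀ + k₁) * (z + f))
      ≡ (4 + k₀ + k₁) * suc (f + suc (y + z))
    expand = solve-∀

  -- The hypothesis forces `c ≥ 1`.

  size-facts : ∀ n → size (encodeFormula (map fact (downFrom n))) ≤ (5 + κ₁) * suc n ^ 2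
  size-facts zero    = s≤s z≤n
  size-facts (suc n) = begin
    suc (suc (κ₁ + suc (size (encodeVar n) + 1)) + size (encodeFormula (map fact (downFrom n))))
      ≤⟨ s≤s (+-mono-≤ (s≤s (+-monoʳ-≤ κ₁ (s≤s (+-monoˡ-≤ 1 (size-encodeVar n))))) (size-facts n)) ⟩
    suc (suc (κ₁ + suc (1 + 4 * n + 1)) + (5 + κ₁) * suc n ^ 2)
      ≤⟨ m≤m+n _ _ ⟩
    suc (suc (κ₁ + suc (1 + 4 * n + 1)) + (5 + κ₁) * suc n ^ 2) + (10 + 6 * n + κ₁ * (2 + 2 * n))
      ≡⟨ expand κ₁ n ⟩
    (5 + κ₁) * suc (suc n) ^ 2 ∎
    where
    open ≤-Reasoning
    expand : ∀ k n →
      suc (suc (k + suc (1 + 4 * n + 1)) + (5 + k) * (suc n * (suc n * 1))) + (10 + 6 * n + k * (2 + 2 * n))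
      ≡ (5 + k) * (suc (suc n) * (suc (suc n) * 1))
    expand = solve-∀

  -- Every run takes at least one step, so the time bound on `n` facts is at least 1. These formulas
  -- have quadratic size, whence the degree `2 * length p`.
  decidable⇒1≤ : ∀ c → DecidableInO* c ^n (SAT ρ (Γ ⁺)) → 1≤ᴿ c
  decidable⇒1≤ c (P , p , decides) {q} c<q =
    monomial-bound⇒1≤ 0<q (sum p * (5 + κ₁) ^ length p) (2 * length p) 1≤
    where
    0<q = ℝ≥0.nonNeg c c<q
    s : ℕ → ℕ
    s n = size (encodeFormula (map fact (downFrom n)))
    poly≤ : ∀ n → p ⟪ s n ⟫ ≤
      sum p * (5 + κ₁) ^ length p * suc n ^ (2 * length p)
    poly≤ n = begin
      p ⟪ s n ⟫
        ≤⟨ ⟪⟫≤ p {s n} ⦃ size-nonZero (encodeFormula (map fact (downFrom n))) ⦄ (size-facts n) ⟩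
      sum p * ((5 + κ₁) * suc n ^ 2) ^ length p
        ≡⟨ cong (sum p *_) (^-distribʳ-* (length p) (5 + κ₁) (suc n ^ 2)) ⟩
      sum p * ((5 + κ₁) ^ length p * (suc n ^ 2) ^ length p)   ≡⟨ *-assoc (sum p) _ _ ⟨
      sum p * (5 + κ₁) ^ length p * (suc n ^ 2) ^ length p
        ≡⟨ cong (sum p * (5 + κ₁) ^ length p *_) (^-*-assoc (suc n) 2 (length p)) ⟩
      sum p * (5 + κ₁) ^ length p * suc n ^ (2 * length p)     ∎
      where open ≤-Reasoning
    -- An exact count is needed: `q` may still lie on either side of 1, so its powers are not known
    -- to be monotone in either direction.
    #vars≡n : ∀ n → #distinct (vars (map fact (downFrom n))) ≡ n
    #vars≡n n = trans (cong #distinct (vars-fact (downFrom n)))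
      (trans (#distinct-Unique (downFrom⁺ n)) (length-downFrom n))
    1≤ : ∀ n → 1ℚ ℚ.≤ fromℕ (sum p * (5 + κ₁) ^ length p * suc n ^ (2 * length p)) ℚ.* q ^ℚ n
    1≤ n with b , t , (_ , P⇓ , _) , _ , t≤ ← decides (map fact (downFrom n)) = begin
      1ℚ                                                ≤⟨ fromℕ-mono (1≤time P⇓) ⟩
      fromℕ t                                           ≤⟨ t≤ c<q ⟩
      fromℕ (p ⟪ s n ⟫) ℚ.* q ^ℚ #distinct (vars (map fact (downFrom n)))
        ≡⟨ cong (λ k → fromℕ (p ⟪ s n ⟫) ℚ.* q ^ℚ k) (#vars≡n n) ⟩
      fromℕ (p ⟪ s n ⟫) ℚ.* q ^ℚ n
        ≤⟨ ℚ.*-monoʳ-≤-nonNeg (q ^ℚ n) ⦃ ^ℚ-nonNeg 0<q n ⦄ (fromℕ-mono (poly≤ n)) ⟩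
      _ ∎
      where open ℚ.≤-Reasoning

-- Assembling the time bound and the theorem.

total-time : ∀ S X α β γ .⦃ _ : NonZero S ⦄ .⦃ _ : NonZero X ⦄ →
  S * α + 15 + (S * (γ * X + β) + 2) ≤ (17 + α + β + γ) * (S * X)
total-time S X α β γ = begin
  S * α + 15 + (S * (γ * X + β) + 2)              ≡⟨ collect S X α β γ ⟩
  17 + S * (α + β) + γ * (S * X)
    ≤⟨ +-monoˡ-≤ (γ * (S * X)) (+-mono-≤ (m≤m*n 17 (S * X) ⦃ m*n≢0 S X ⦄) (*-monoˡ-≤ (α + β) (m≤m*n S X))) ⟩
  17 * (S * X) + S * X * (α + β) + γ * (S * X)    ≡⟨ factor (S * X) α β γ ⟩
  (17 + α + β + γ) * (S * X)                      ∎
  where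
  open ≤-Reasoning
  collect : ∀ s x α β γ → s * α + 15 + (s * (γ * x + β) + 2) ≡ 17 + s * (α + β) + γ * (s * x)
  collect = solve-∀
  factor : ∀ y α β γ → 17 * y + y * (α + β) + γ * y ≡ (17 + α + β + γ) * y
  factor = solve-∀

theorem24 : ∀ {ℓ} (ρ : Representation) (Γ : Language ℓ) → OneValid Γ →
    (c : ℝ≥0) → c ≤ᴿ fromℕ 2 →
    DecidableInO* c ^n (SAT ρ (Γ ⁺)) →
    DecidableInO* c ^n (P-ABD ρ Γ)
theorem24 {ℓ} ρ Γ 1-valid c _ sat@(P , p , decides) = program d₁ , monomial C (suc d) , correct
  where
  open Reduction ρ Γ
  open Representation ρ
  d₀ d₁ : Tree
  d₀ = code name₀
  d₁ = code name₁
  open Oracle P d₀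
  -- `α` is the cost per hypothesis and `β` the overhead per call; `γ * S ^ d` bounds the oracle's
  -- polynomial on a query, where `S` is the size of the instance. The further degree in `suc d`
  -- pays for the at most `S` rounds of each loop.
  d α β γ C : ℕ
  d = length p
  α = assumeTime d₁
  β = 2 + callTime
  γ = sum p * κ ^ d
  C = 17 + α + β + γ
  1≤c : 1≤ᴿ c
  1≤c = decidable⇒1≤ c sat

  correct : ∀ I → ∃₂ λ b t → program d₁ on Problem.encode (P-ABD ρ Γ) I ⇒ bool b [ t ] ×
    Reflects (∃ (Explanation I)) b ×
    t ≤ monomial C (suc d) ⟪ size (Problem.encode (P-ABD ρ Γ) I) ⟫ · c ^ᴿ Problem.#vars (P-ABD ρ Γ) I
  correct I = finish (run-program 1≤c {a = γ * S ^ d} {n} {S = λ m → Sat (query I m)} d₁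
      {encodeFormula KB} {map encodeVar H} {M}
      (trans (encode-assuming H (map embed KB)) (cong (addUnits d₁ (map encodeVar H)) (encode-embed KB)))
      (All.tabulate answered))
    where
    open AbductionInstance I
    n S : ℕ
    n = #distinct (vars KB ++ H ++ M)
    S = size (Problem.encode (P-ABD ρ Γ) I)
    B : Tree
    B = encodeFormula (assuming H (map embed KB))

    poly≤ : ∀ {m} → m ∈ M → p ⟪ size (encodeFormula (query I m)) ⟫ ≤ γ * S ^ d
    poly≤ {m} m∈M = begin
      p ⟪ size (encodeFormula (query I m)) ⟫  ≤⟨ ⟪⟫≤ p (size-query I m∈M) ⟩
      sum p * (κ * S) ^ d                     ≡⟨ cong (sum p *_) (^-distribʳ-* d κ S) ⟩
      sum p * (κ ^ d * S ^ d)                 ≡⟨ *-assoc (sum p) _ _ ⟨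
      γ * S ^ d                               ∎
      where open ≤-Reasoning

    answered : ∀ {m} → m ∈ M → Answered 1≤c {γ * S ^ d} {n} {S = λ m → Sat (query I m)} {B} m
    answered {m} m∈M with b , t , P⇓ , reflects , t≤ ← decides (query I m) =
      -- By `1≤c` the exponent of the query's bound can be raised to the common `n`.
      b , t , P⇓ , reflects , ≤[]-mono 1≤c (poly≤ m∈M) (#vars-query I m∈M) (bounded t≤)

    total≤ : suc (length (map encodeVar H)) * α + 15 + (suc (length M) * (γ * S ^ d + β) + 2) ≤
      monomial C (suc d) ⟪ S ⟫
    total≤ = begin
      suc (length (map encodeVar H)) * α + 15 + (suc (length M) * (γ * S ^ d + β) + 2)
        ≡⟨ cong (λ l → suc l * α + 15 + (suc (length M) * (γ * S ^ d + β) + 2)) (length-map encodeVar H) ⟩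
      suc (length H) * α + 15 + (suc (length M) * (γ * S ^ d + β) + 2)
        ≤⟨ +-mono-≤ (+-monoˡ-≤ 15 (*-monoˡ-≤ α H<S)) (+-monoˡ-≤ 2 (*-monoˡ-≤ (γ * S ^ d + β) M<S)) ⟩
      S * α + 15 + (S * (γ * S ^ d + β) + 2)
        ≤⟨ total-time S (S ^ d) α β γ ⦃ _ ⦄ ⦃ m^n≢0 S d ⦄ ⟩
      C * S ^ suc d
        ≡⟨ monomial-⟪⟫ C (suc d) S ⟨
      monomial C (suc d) ⟪ S ⟫ ∎
      where
      open ≤-Reasoning
      f = size (encodeFormula KB)
      H<S : suc (length H) ≤ S
      H<S = ≤-trans (length<size-encodeVars H) (m≤n⇒m≤1+n (m≤n⇒m≤o+n f (m≤n⇒m≤1+n (m≤m+n _ _))))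
      M<S : suc (length M) ≤ S
      M<S = ≤-trans (length<size-encodeVars M)
        (m≤n⇒m≤1+n (m≤n⇒m≤o+n f (m≤n⇒m≤1+n (m≤n+m _ (size (encodeVars H))))))

    finish : (∃₂ λ b t → program d₁ on Problem.encode (P-ABD ρ Γ) I ⇒ bool b [ t ] ×
        Reflects (All (λ m → ¬ Sat (query I m)) M) b ×
        t ≤[ c , n ] suc (length (map encodeVar H)) * α + 15 + (suc (length M) * (γ * S ^ d + β) + 2)) →
      ∃₂ λ b t → program d₁ on Problem.encode (P-ABD ρ Γ) I ⇒ bool b [ t ] ×
        Reflects (∃ (Explanation I)) b ×
        t ≤ monomial C (suc d) ⟪ S ⟫ · c ^ᴿ n
    finish (b , t , run , reflects , t≤) =
      b , t , run , explained reflects , bound (≤[]-mono 1≤c total≤ ≤-refl t≤)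
      where
      explained : ∀ {b} → Reflects (All (λ m → ¬ Sat (query I m)) M) b → Reflects (∃ (Explanation I)) b
      explained (ofʸ unsat)  = ofʸ (all-refuted⇒explanation I 1-valid unsat)
      explained (ofⁿ ¬unsat) = ofⁿ (¬unsat ∘ explanation⇒all-refuted I)
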